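{- Let $k\ge 3$ and let $\sigma=\sigma_1\sigma_2\cdots\sigma_k\text{ - }\sigma_{k+1}$ be a quasi-consecutive vincular pattern (with $\sigma_1\cdots\sigma_{k+1}\in S_{k+1}$) such that $\sigma_{k+1}=\sigma_i+1$ for some $2\le i\le k-1$. Let $$\tau=\sigma_1\cdots\sigma_{i-1}\,\sigma_{k+1}\,\sigma_{i+1}\cdots\sigma_k\text{ - }\sigma_i$$ be the pattern obtained by interchanging $\sigma_i$ and $\sigma_{k+1}$. Suppose that $$\sigma_1\cdots\sigma_z\not\sim\sigma_{k-z+1}\cdots\sigma_k$$ for all integers $z$ with $\min(i,k-i+1)\le z<k$. Then $\sigma\equiv\tau$, i.e. $\sigma$ and $\tau$ are Wilf-equivalent.
   Context: $S_n$ is the set of permutations of $\{1,\dots,n\}$ in one-line notation. Two sequences of positive integers of the same length are order-isomorphic, $a_1\cdots a_m\sim b_1\cdots b_m$, if for all $p,q$ one has $a_p<a_q$ iff $b_p<b_q$. A permutation $\pi\in S_n$ contains the quasi-consecutive pattern $\sigma_1\cdots\sigma_k\text{ - }\sigma_{k+1}$ if there are indices $1\le i_1<\cdots<i_{k+1}\le n$ with $i_{p+1}=i_p+1$ for $1\le p\le k-1$ and $\pi_{i_1}\cdots\pi_{i_{k+1}}\sim\sigma_1\cdots\sigma_{k+1}$; otherwise it avoids it. $S_n(\sigma)$ is the set of permutations in $S_n$ avoiding $\sigma$. Patterns $\sigma,\tau$ are Wilf-equivalent, $\sigma\equiv\tau$, if $|S_n(\sigma)|=|S_n(\tau)|$ for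 every positive integer $n$. -}

module Defs where

open import Data.Fin.Base
  using (Fin; toℕ; cast; fromℕ; inject₁; inject≤; _↑ʳ_) renaming (_<_ to _<ᶠ_)
open import Data.Fin.Permutation
  using (Permutation′; _⟨$⟩ʳ_; _∘ₚ_; transpose) renaming (_≈_ to _≈ₚ_)
open import Data.Nat.Base using (ℕ; suc; _≤_; _<_; _∸_)
open import Data.Nat.Properties using (m∸n+n≡m)
open import Data.Product.Base using (Σ; _×_; ∃-syntax; proj₁)
open import Data.Vec.Functional using (Vector)
open import Function.Base using (_∘_)
open import Function.Bundles using (_⇔_; Inverse)
open import Level using (0ℓ)
open import Relation.Binary.Bundles using (Setoid)
open import Relation.Binary.PropositionalEquality.Core using (_≡_; refl; sym; trans)
open import Relation.Binary.PropositionalEquality.Properties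
  using () renaming (setoid to ≡-setoid)
open import Relation.Nullary.Negation.Core using (¬_)

private
  variable
    k l m n z : ℕ

-- Positions are counted from 0 (elements of Fin), values from 1.
oneLine : Permutation′ n → Vector ℕ n
oneLine π p = suc (toℕ (π ⟨$⟩ʳ p))

infix 4 _∼_

_∼_ : Vector ℕ m → Vector ℕ m → Set
a ∼ b = ∀ p q → (a p < a q) ⇔ (b p < b q)

prefix : z ≤ m → Vector ℕ m → Vector ℕ z
prefix z≤m a p = a (inject≤ p z≤m)

suffix : z ≤ m → Vector ℕ m → Vector ℕ z
suffix {z} {m} z≤m a p = a (cast (m∸n+n≡m z≤m) ((m ∸ z) ↑ʳ p))

-- The vincular pattern σ₁⋯σₖ-σₖ₊₁ is given by its underlying permutation.
-- The index inject₁ p, for p : Fin k, is a position before the dash, and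
-- fromℕ k is the position after it.
QuasiConsecutive : ℕ → Set
QuasiConsecutive k = Permutation′ (suc k)

consecutivePart : QuasiConsecutive k → Vector ℕ k
consecutivePart σ = oneLine σ ∘ inject₁

lastEntry : QuasiConsecutive k → ℕ
lastEntry {k} σ = oneLine σ (fromℕ k)

record Occurrence {k n} (σ : QuasiConsecutive k) (π : Permutation′ n) : Set where
  field
    index      : Fin (suc k) → Fin n
    increasing : ∀ p q → p <ᶠ q → index p <ᶠ index q
    adjacent   : ∀ (p q : Fin k) → toℕ q ≡ suc (toℕ p) →
                 toℕ (index (inject₁ q)) ≡ suc (toℕ (index (inject₁ p)))
    similar    : oneLine π ∘ index ∼ oneLine σ

Avoids : QuasiConsecutive k → Permutation′ n → Set
Avoids σ π = ¬ Occurrence σ π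

-- Sₙ(σ), with permutations identified when they have the same one-line
-- notation; in particular the proof of avoidance is ignored.
S : ∀ n → QuasiConsecutive k → Setoid 0ℓ 0ℓ
S n σ = record
  { Carrier       = Σ (Permutation′ n) (Avoids σ)
  ; _≈_           = λ π ρ → proj₁ π ≈ₚ proj₁ ρ
  ; isEquivalence = record
    { refl  = λ _ → refl
    ; sym   = λ e p → sym (e p)
    ; trans = λ e f p → trans (e p) (f p)
    }
  }

HasCardinality : ∀ {a ℓ} → Setoid a ℓ → ℕ → Set _
HasCardinality A c = Inverse A (≡-setoid (Fin c))

WilfEquivalent : QuasiConsecutive k → QuasiConsecutive l → Set
WilfEquivalent σ τ =
  ∀ n → 1 ≤ n → ∃[ c ] (HasCardinality (S n σ) c × HasCardinality (S n τ) c)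

-- σ₁⋯σᵢ₋₁ σₖ₊₁ σᵢ₊₁⋯σₖ-σᵢ.  In ρ ∘ₚ σ the permutation ρ is applied first, so
-- the transposition acts on positions.
swapWithLast : Fin k → QuasiConsecutive k → QuasiConsecutive k
swapWithLast {k} i σ = transpose (inject₁ i) (fromℕ k) ∘ₚ σ

-- Call a window an interval of k consecutive positions. An occurrence of σ is
-- a window order-isomorphic to σ₁⋯σₖ together with a later entry that is, among
-- the entries of the window, the next larger one after its i-th entry; for τ
-- replace "larger" by "smaller". The overlap hypothesis says that two windows
-- matching σ₁⋯σₖ never contain each other's i-th position. So the windows can
-- be treated from left to right: as long as some later entry makes the current
-- window an occurrence of τ, swap its i-th entry x with the greatest entry
-- below x to the right of the window's start. Such a swap preserves all
-- matches and the status of every other window, and it can be undone, since x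
-- becomes the least entry above the new i-th entry. If the window is initially
-- not an occurrence of σ, the start of a sequence of swaps is therefore
-- determined by its end. This embeds the avoiders of σ into those of τ, and
-- the same argument for the reversed order embeds the avoiders of τ into those
-- of σ.

module Submission where

open import Defs
open import Data.Bool.Base using (true; false)
open import Data.Fin.Base
  using (Fin; zero; suc; toℕ; fromℕ; fromℕ<; inject₁; inject≤; cast; _↑ʳ_; combine; funToFin; finToFun)
  renaming (_<_ to _<ᶠ_)
open import Data.Fin.Induction using (spo-wellFounded; spo-noetherian)
open import Data.Fin.Permutation
  using (Permutation′; _⟨$⟩ʳ_; _⟨$⟩ˡ_; _∘ₚ_; transpose; permutation; inverseˡ; inverseʳ)
  renaming (_≈_ to _≈ₚ_)
import Data.Fin.Permutation.Components as PC
open import Data.Fin.Properties as Fin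
  using ( _≟_; any?; all?; toℕ-injective; toℕ<n; toℕ-fromℕ; toℕ-fromℕ<; toℕ-inject₁; toℕ-inject≤; toℕ-cast; toℕ-↑ʳ
        ; inject₁-injective; fromℕ≢inject₁; injective⇒≤; funToFin-finToFin; finToFun-funToFin)
open import Data.Fin.Relation.Unary.Top using (view; view-fromℕ; view-inject₁; ‵fromℕ; ‵inject₁)
open import Data.List.Base using (List; length; lookup; filter; allFin)
open import Data.List.Membership.Propositional.Properties using (∈-filter⁺; ∈-filter⁻; ∈-allFin; ∈-lookup)
open import Data.List.Relation.Unary.All as All using ()
open import Data.List.Relation.Unary.AllPairs using (_∷_)
import Data.List.Relation.Unary.Any as Any
open import Data.List.Relation.Unary.Any.Properties using (lookup-index)
open import Data.List.Relation.Unary.Unique.Propositional using (Unique)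
open import Data.List.Relation.Unary.Unique.Propositional.Properties using (allFin⁺; filter⁺)
open import Data.Nat.Base using (ℕ; zero; suc; _≤_; _<_; _>_; _+_; _∸_; _⊓_; _^_; s≤s)
open import Data.Nat.Properties as ℕ hiding (_≟_)
open import Data.Product.Base using (_×_; _,_; ∃-syntax; Σ-syntax; proj₁; proj₂)
open import Data.Sum.Base using (inj₁; inj₂)
open import Data.Vec.Functional using (Vector)
open import Function.Base using (_∘_; flip; _on_; id)
open import Function.Bundles using (_⇔_; mk⇔; Equivalence; Inverse; Injection)
open import Function.Construct.Symmetry using () renaming (inverse to inverse-sym)
open import Function.Properties.Inverse using (Inverse⇒Injection)
open import Induction.WellFounded using (WellFounded; Acc; acc)
open import Level using (0ℓ)
open import Relation.Binary.Bundles using (Setoid)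
open import Relation.Binary.Construct.Closure.ReflexiveTransitive using (Star; ε; _◅_)
import Relation.Binary.Construct.Flip.EqAndOrd as Flip
import Relation.Binary.Construct.On as On
open import Relation.Binary.Core using (Rel)
open import Relation.Binary.Definitions using (tri<; tri≈; tri>)
open import Relation.Binary.PropositionalEquality
open import Relation.Binary.Structures using (IsStrictTotalOrder)
open import Relation.Nullary using (¬_; Dec; does; yes; no; contradiction)
open import Relation.Nullary.Decidable using (map′; _×-dec_; _→-dec_; dec-true; dec-false)
open import Relation.Unary using (Pred; Decidable)

open Equivalence using (to; from)

private
  variable
    k m n j j′ : ℕ

-- Decidable equivalence, transpositions and one-line notation

_⇔-dec_ : ∀ {A B : Set} → Dec A → Dec B → Dec (A ⇔ B)
a? ⇔-dec b? = map′ (λ (f , g) → mk⇔ f g) (λ e → to e , from e) ((a? →-dec b?) ×-dec (b? →-dec a?))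

transpose-at-left : (x y : Fin n) → PC.transpose x y x ≡ y
transpose-at-left x y rewrite dec-true (x ≟ x) refl = refl

transpose-at-right : (x y : Fin n) → PC.transpose x y y ≡ x
transpose-at-right x y with y ≟ x
... | yes y≡x = y≡x
... | no  _   rewrite dec-true (y ≟ y) refl = refl

transpose-elsewhere : {x y r : Fin n} → r ≢ x → r ≢ y → PC.transpose x y r ≡ r
transpose-elsewhere {x = x} {y} {r} r≢x r≢y
  rewrite dec-false (r ≟ x) r≢x | dec-false (r ≟ y) r≢y = refl

transpose-preserves : (P : Fin n → Set) {x y r : Fin n} → P y → P x → P r → P (PC.transpose x y r)
transpose-preserves P {x} {y} {r} Py Px Pr with does (r ≟ x)
... | true  = Py
... | false with does (r ≟ y)
...   | true  = Px
...   | false = Pr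

oneLine-injective : (π : Permutation′ n) {p q : Fin n} → oneLine π p ≡ oneLine π q → p ≡ q
oneLine-injective π {p} {q} e = begin
  p                   ≡⟨ inverseˡ π ⟨
  π ⟨$⟩ˡ (π ⟨$⟩ʳ p)   ≡⟨ cong (π ⟨$⟩ˡ_) (toℕ-injective (suc-injective e)) ⟩
  π ⟨$⟩ˡ (π ⟨$⟩ʳ q)   ≡⟨ inverseˡ π ⟩
  q                   ∎
  where open ≡-Reasoning

-- Order isomorphism

infix 4 _∼[_]_

-- The relation is a parameter so that one argument serves both `_<_` and `_>_`; the wrapping record
-- lets `a`, `b` and `R` be inferred.
record _∼[_]_ {m} (a : Vector ℕ m) (R : Rel ℕ 0ℓ) (b : Vector ℕ m) : Set where
  constructor orderIso
  field
    compares : ∀ p q → R (a p) (a q) ⇔ R (b p) (b q)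

open _∼[_]_

∼[]-sym : ∀ {R} {a b : Vector ℕ m} → a ∼[ R ] b → b ∼[ R ] a
∼[]-sym a∼b = orderIso λ p q → mk⇔ (from (compares a∼b p q)) (to (compares a∼b p q))

∼[]-trans : ∀ {R} {a b c : Vector ℕ m} → a ∼[ R ] b → b ∼[ R ] c → a ∼[ R ] c
∼[]-trans a∼b b∼c = orderIso λ p q → mk⇔
  (to (compares b∼c p q) ∘ to (compares a∼b p q))
  (from (compares a∼b p q) ∘ from (compares b∼c p q))

∼[]-flip : ∀ {R} {a b : Vector ℕ m} → a ∼[ R ] b → a ∼[ flip R ] b
∼[]-flip a∼b = orderIso λ p q → compares a∼b q p

∼[]-∘ : ∀ {R} {a b : Vector ℕ m} (g : Fin n → Fin m) → a ∼[ R ] b → a ∘ g ∼[ R ] b ∘ g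
∼[]-∘ g a∼b = orderIso λ p q → compares a∼b (g p) (g q)

≗⇒∼[] : ∀ {R} {a b : Vector ℕ m} → a ≗ b → a ∼[ R ] b
≗⇒∼[] {R = R} a≗b = orderIso λ p q →
  mk⇔ (subst₂ R (a≗b p) (a≗b q)) (subst₂ R (sym (a≗b p)) (sym (a≗b q)))

-- For R = _<_ the last entry is the next larger one after the i-th entry,
-- and for R = _>_ it is the next smaller one.
record NextAfter {k} (R : Rel ℕ 0ℓ) (i : Fin k) (a : Vector ℕ (suc k)) : Set where
  constructor nextAfter
  field
    related : R (a (inject₁ i)) (a (fromℕ k))
    closest : ∀ p → R (a (inject₁ i)) (a (inject₁ p)) → R (a (fromℕ k)) (a (inject₁ p))

NextAfter-resp-∼ : ∀ {R} {i : Fin k} {a b} → a ∼[ R ] b → NextAfter R i a → NextAfter R i b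
NextAfter-resp-∼ a∼b (nextAfter r c) =
  nextAfter (to (compares a∼b _ _) r) λ p → to (compares a∼b _ _) ∘ c p ∘ from (compares a∼b _ _)

-- A window starting at position j, followed by one entry to its right.
record Embedding {k n} (j : ℕ) (e : Fin (suc k) → Fin n) : Set where
  field
    window : ∀ p → toℕ (e (inject₁ p)) ≡ j + toℕ p
    beyond : j + k ≤ toℕ (e (fromℕ k))

  start≤ : ∀ p → j ≤ toℕ (e p)
  start≤ p with view p
  ... | ‵fromℕ     = ≤-trans (m≤m+n j k) beyond
  ... | ‵inject₁ q = ≤-trans (m≤m+n j (toℕ q)) (≤-reflexive (sym (window q)))

  window<beyond : ∀ p → toℕ (e (inject₁ p)) < toℕ (e (fromℕ k))
  window<beyond p = ≤-trans (≤-trans (≤-reflexive (cong suc (window p))) (+-monoʳ-< j (toℕ<n p))) beyond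

open Embedding

snoc : ∀ {A : Set} → (Fin k → A) → A → Fin (suc k) → A
snoc w y p with view p
... | ‵fromℕ     = y
... | ‵inject₁ q = w q

snoc-inject₁ : ∀ {A : Set} (w : Fin k → A) y p → snoc w y (inject₁ p) ≡ w p
snoc-inject₁ w y p rewrite view-inject₁ p = refl

snoc-fromℕ : ∀ {A : Set} (w : Fin k → A) y → snoc w y (fromℕ k) ≡ y
snoc-fromℕ {k} w y rewrite view-fromℕ k = refl

-- For two matching windows, the left one has its i-th position before the right one starts, and the
-- right one has its i-th position after the left one ends. Quantifying over `f` makes this
-- available before and after every swap.
IsolatedMatches : Rel ℕ 0ℓ → Vector ℕ k → Fin k → ℕ → Set
IsolatedMatches {k} R s i n = ∀ (f : Fin n → ℕ) {j j′ e e′} →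
  Embedding j e → Embedding j′ e′ →
  f ∘ e ∘ inject₁ ∼[ R ] s → f ∘ e′ ∘ inject₁ ∼[ R ] s →
  j < j′ → j + toℕ i < j′ × j + k ≤ j′ + toℕ i

-- Swaps in matching windows

module Descent
  (_≺_ : Rel ℕ 0ℓ) (isSTO : IsStrictTotalOrder _≡_ _≺_)
  {k n : ℕ} (s : Vector ℕ k) (i : Fin k)
  (isolated : IsolatedMatches _≺_ s i n)
  where

  open IsStrictTotalOrder isSTO
    using (compare; irrefl; asym) renaming (trans to ≺-trans; _<?_ to _≺?_)

  Match : Permutation′ n → (Fin k → Fin n) → Set
  Match π w = oneLine π ∘ w ∼[ _≺_ ] s

  -- For `R = _≺_` this will be an occurrence of the pattern avoided at the outset, for `flip _≺_`
  -- one of the pattern to be avoided at the end.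
  Violation : Rel ℕ 0ℓ → Permutation′ n → ℕ → Set
  Violation R π j = ∃[ e ] (Embedding j e × Match π (e ∘ inject₁) × NextAfter R i (oneLine π ∘ e))

  -- The invariant during the treatment of window `j`: swaps there may change the status of that
  -- window only, so nothing is asked of it.
  OthersClean : ℕ → Permutation′ n → Set
  OthersClean j π = ∀ j′ →
    (j′ < j → ¬ Violation (flip _≺_) π j′) × (j < j′ → ¬ Violation _≺_ π j′)

  -- The windows starting before j have already been treated.
  Clean : ℕ → Permutation′ n → Set
  Clean j π = ∀ j′ →
    (j′ < j → ¬ Violation (flip _≺_) π j′) × (j ≤ j′ → ¬ Violation _≺_ π j′)

  -- By `below` and `gap`, `y` carries the greatest entry below that of `x` among all positions from
  -- `j` on, inside the window or beyond it. This long range of `gap` is what preserves order in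
  -- later windows and makes the swap reversible.
  record Move (j : ℕ) (π π′ : Permutation′ n) : Set where
    field
      e         : Fin (suc k) → Fin n
      embedding : Embedding j e
      match     : Match π (e ∘ inject₁)

    x = e (inject₁ i)
    y = e (fromℕ k)
    f = oneLine π
    f′ = oneLine π′

    field
      below    : f y ≺ f x
      gap      : ∀ r → j ≤ toℕ r → f y ≺ f r → ¬ f r ≺ f x
      swapped  : π′ ≈ₚ transpose x y ∘ₚ π

    x<y : toℕ x < toℕ y
    x<y = window<beyond embedding i

    at-x : f′ x ≡ f y
    at-x = trans (cong (suc ∘ toℕ) (swapped x)) (cong f (transpose-at-left x y))

    at-y : f′ y ≡ f x
    at-y = trans (cong (suc ∘ toℕ) (swapped y)) (cong f (transpose-at-right x y))

    elsewhere : ∀ {r} → r ≢ x → r ≢ y → f′ r ≡ f r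
    elsewhere {r} r≢x r≢y = trans (cong (suc ∘ toℕ) (swapped r)) (cong f (transpose-elsewhere r≢x r≢y))

    unswapped : π ≈ₚ transpose y x ∘ₚ π′
    unswapped r = trans (cong (π ⟨$⟩ʳ_) (sym (PC.transpose-inverse x y))) (sym (swapped _))

    above-x : ∀ {r} → j ≤ toℕ r → r ≢ x → f y ≺ f r → f x ≺ f r
    above-x {r} j≤r r≢x y≺r with compare (f x) (f r)
    ... | tri< x≺r _ _ = x≺r
    ... | tri≈ _ x≡r _ = contradiction (sym (oneLine-injective π x≡r)) r≢x
    ... | tri> _ _ r≺x = contradiction r≺x (gap r j≤r y≺r)

    below-y : ∀ {r} → j ≤ toℕ r → r ≢ y → f r ≺ f x → f r ≺ f y
    below-y {r} j≤r r≢y r≺x with compare (f r) (f y)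
    ... | tri< r≺y _ _ = r≺y
    ... | tri≈ _ r≡y _ = contradiction (oneLine-injective π r≡y) r≢y
    ... | tri> _ _ y≺r = contradiction r≺x (gap r j≤r y≺r)

    -- Away from `y` only the entry at `x` changes: it drops to `f y`, and by `gap` passes no other
    -- entry on the way.
    monotone-off-y : ∀ {u v} → j ≤ toℕ u → j ≤ toℕ v → u ≢ y → v ≢ y → f u ≺ f v → f′ u ≺ f′ v
    monotone-off-y {u} {v} j≤u j≤v u≢y v≢y u≺v with u ≟ x | v ≟ x
    ... | yes refl | yes refl = contradiction u≺v (irrefl refl)
    ... | yes refl | no v≢x   = subst₂ _≺_ (sym at-x) (sym (elsewhere v≢x v≢y)) (≺-trans below u≺v)
    ... | no u≢x   | yes refl = subst₂ _≺_ (sym (elsewhere u≢x u≢y)) (sym at-x) (below-y j≤u u≢y u≺v)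
    ... | no u≢x   | no v≢x   = subst₂ _≺_ (sym (elsewhere u≢x u≢y)) (sym (elsewhere v≢x v≢y)) u≺v

    -- Dually, away from `x` only the entry at `y` changes, and it rises through the same gap.
    monotone-off-x : ∀ {u v} → j ≤ toℕ u → j ≤ toℕ v → u ≢ x → v ≢ x → f u ≺ f v → f′ u ≺ f′ v
    monotone-off-x {u} {v} j≤u j≤v u≢x v≢x u≺v with u ≟ y | v ≟ y
    ... | yes refl | yes refl = contradiction u≺v (irrefl refl)
    ... | yes refl | no v≢y   = subst₂ _≺_ (sym at-y) (sym (elsewhere v≢x v≢y)) (above-x j≤v v≢x u≺v)
    ... | no u≢y   | yes refl = subst₂ _≺_ (sym (elsewhere u≢x u≢y)) (sym at-y) (≺-trans u≺v below)
    ... | no u≢y   | no v≢y   = subst₂ _≺_ (sym (elsewhere u≢x u≢y)) (sym (elsewhere v≢x v≢y)) u≺v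

    -- By totality, reflecting a comparison follows from preserving the opposite one.
    reflects : ∀ {u v} → (f v ≺ f u → f′ v ≺ f′ u) → f′ u ≺ f′ v → f u ≺ f v
    reflects {u} {v} mono u≺′v with compare (f u) (f v)
    ... | tri< u≺v _ _ = u≺v
    ... | tri≈ _ u≡v _ = contradiction u≺′v (irrefl (cong f′ (oneLine-injective π u≡v)))
    ... | tri> _ _ v≺u = contradiction u≺′v (asym (mono v≺u))

    order-off-y : ∀ {m} {w : Fin m → Fin n} → (∀ p → j ≤ toℕ (w p)) → (∀ p → w p ≢ y) → f ∘ w ∼[ _≺_ ] f′ ∘ w
    order-off-y j≤ ≢y = orderIso λ p q → mk⇔
      (monotone-off-y (j≤ p) (j≤ q) (≢y p) (≢y q))
      (reflects (monotone-off-y (j≤ q) (j≤ p) (≢y q) (≢y p)))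

    order-off-x : ∀ {m} {w : Fin m → Fin n} → (∀ p → j ≤ toℕ (w p)) → (∀ p → w p ≢ x) → f ∘ w ∼[ _≺_ ] f′ ∘ w
    order-off-x j≤ ≢x = orderIso λ p q → mk⇔
      (monotone-off-x (j≤ p) (j≤ q) (≢x p) (≢x q))
      (reflects (monotone-off-x (j≤ q) (j≤ p) (≢x q) (≢x p)))

    match′ : Match π′ (e ∘ inject₁)
    match′ = ∼[]-trans
      (∼[]-sym (order-off-y (start≤ embedding ∘ inject₁)
        (λ p p≡y → <-irrefl (cong toℕ p≡y) (window<beyond embedding p))))
      match

    -- The two swapped entries still have nothing of the window between them, now with the larger
    -- one at `y`. Hence every move leaves a violation for `_≺_`, by which the start of a path is
    -- recognised later.
    y-next-after : NextAfter _≺_ i (f′ ∘ e)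
    y-next-after = nextAfter (subst₂ _≺_ (sym at-x) (sym at-y) below) closest
      where
      closest : ∀ p → f′ x ≺ f′ (e (inject₁ p)) → f′ y ≺ f′ (e (inject₁ p))
      closest p x≺′p with e (inject₁ p) ≟ x
      ... | yes p≡x = contradiction x≺′p (irrefl (cong f′ (sym p≡x)))
      ... | no  p≢x = subst₂ _≺_ (sym at-y) (sym p-fixed)
              (above-x (start≤ embedding (inject₁ p)) p≢x (subst₂ _≺_ at-x p-fixed x≺′p))
        where
        p-fixed = elsewhere p≢x λ p≡y → <-irrefl (cong toℕ p≡y) (window<beyond embedding p)

    -- The gap survives the swap, so `y` now carries the least entry above that of `x` from `j` on;
    -- this determines `y` from `π′`.
    gap′ : ∀ {r} → j ≤ toℕ r → f′ x ≺ f′ r → ¬ f′ r ≺ f′ y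
    gap′ {r} j≤r x≺′r r≺′y with r ≟ x | r ≟ y
    ... | yes refl | _        = irrefl refl x≺′r
    ... | no _     | yes refl = irrefl refl r≺′y
    ... | no r≢x   | no r≢y   =
      gap r j≤r (subst₂ _≺_ at-x (elsewhere r≢x r≢y) x≺′r) (subst₂ _≺_ (elsewhere r≢x r≢y) at-y r≺′y)

  -- Effect of a swap on the other windows

  module _ {R : Rel ℕ 0ℓ} (≺⇒R : ∀ {m} {a b : Vector ℕ m} → a ∼[ _≺_ ] b → a ∼[ R ] b)
           {j j′ : ℕ} {π π′ : Permutation′ n} (move : Move j π π′) where

    open Move move

    -- By isolation `x` lies left of the later window, so neither this window nor its extra entry
    -- uses `x`, and all comparisons off `x` are unchanged.
    violation-right : j < j′ → Violation R π′ j′ → Violation R π j′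
    violation-right j<j′ (e′ , emb′ , m′ , next) =
      e′ , emb′ , ∼[]-trans (∼[]-∘ inject₁ same) m′ ,
      NextAfter-resp-∼ (≺⇒R (∼[]-sym same)) next
      where
      x-left : j + toℕ i < j′
      x-left = proj₁ (isolated f′ embedding emb′ match′ m′ j<j′)
      same : f ∘ e′ ∼[ _≺_ ] f′ ∘ e′
      same = order-off-x (λ p → ≤-trans (<⇒≤ j<j′) (start≤ emb′ p))
        λ p p≡x → <⇒≢ (<-≤-trans x-left (start≤ emb′ p))
                       (trans (sym (window embedding i)) (cong toℕ (sym p≡x)))

    -- By isolation the earlier window ends before `x`, so the swap can touch at most its extra
    -- entry. Moving that entry along with the swap restores the old values, and both `x` and `y`
    -- are beyond the window.
    violation-left : j′ < j → Violation R π′ j′ → Violation R π j′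
    violation-left j′<j (e′ , emb′ , m′ , next) =
      t ∘ e′ , emb , ∼[]-trans (≗⇒∼[] (sym ∘ moved ∘ inject₁)) m′ ,
      NextAfter-resp-∼ (≗⇒∼[] moved) next
      where
      t : Fin n → Fin n
      t = PC.transpose x y
      moved : ∀ p → f′ (e′ p) ≡ f (t (e′ p))
      moved p = cong (suc ∘ toℕ) (swapped (e′ p))
      x-right : j′ + k ≤ toℕ x
      x-right = subst (j′ + k ≤_) (sym (window embedding i))
        (proj₂ (isolated f′ emb′ embedding m′ match′ j′<j))
      before : ∀ p → toℕ (e′ (inject₁ p)) < toℕ x
      before p = <-≤-trans (≤-trans (≤-reflexive (cong suc (window emb′ p))) (+-monoʳ-< j′ (toℕ<n p))) x-right
      emb : Embedding j′ (t ∘ e′)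
      emb = record
        { window = λ p → trans
            (cong toℕ (transpose-elsewhere (<⇒≢ (before p) ∘ cong toℕ) (<⇒≢ (<-trans (before p) x<y) ∘ cong toℕ)))
            (window emb′ p)
        ; beyond = transpose-preserves (λ r → j′ + k ≤ toℕ r)
            (≤-trans x-right (<⇒≤ x<y)) x-right (beyond emb′)
        }

  others-clean : ∀ {j π π′} → Move j π π′ → OthersClean j π → OthersClean j π′
  others-clean move clean j′ =
    (λ j′<j → proj₁ (clean j′) j′<j ∘ violation-left ∼[]-flip move j′<j) ,
    (λ j<j′ → proj₂ (clean j′) j<j′ ∘ violation-right id move j<j′)

  violation-resp-≈ : ∀ {R j} (π ρ : Permutation′ n) → π ≈ₚ ρ → Violation R π j → Violation R ρ j
  violation-resp-≈ π ρ π≈ρ (e , emb , m , next) =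
    e , emb , ∼[]-trans (≗⇒∼[] (λ p → cong (suc ∘ toℕ) (sym (π≈ρ _)))) m ,
    NextAfter-resp-∼ (≗⇒∼[] (λ p → cong (suc ∘ toℕ) (π≈ρ (e p)))) next

  -- Paths run backwards: a Path j π′ π leads from π to π′ by moves.
  Path : ℕ → Permutation′ n → Permutation′ n → Set
  Path j = Star (flip (Move j))

  move-violates : ∀ {j π π′} → Move j π π′ → Violation _≺_ π′ j
  move-violates move = Move.e move , Move.embedding move , Move.match′ move , Move.y-next-after move

  -- Both moves have `x` at the i-th position of window `j`. Each `y` carries the least entry above
  -- `x` after the swap, so each `gap′` keeps the other `y` from being smaller.
  move-backwards-unique : ∀ {j π₁ π₂ π₁′ π₂′} → π₁′ ≈ₚ π₂′ → Move j π₁ π₁′ → Move j π₂ π₂′ → π₁ ≈ₚ π₂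
  move-backwards-unique {π₁ = π₁} {π₂} {π₁′} {π₂′} ≈′ M₁ M₂ r = begin
    π₁ ⟨$⟩ʳ r                                 ≡⟨ M₁.unswapped r ⟩
    π₁′ ⟨$⟩ʳ PC.transpose M₁.y M₁.x r         ≡⟨ cong₂ (λ x y → π₁′ ⟨$⟩ʳ PC.transpose y x r) same-x same-y ⟩
    π₁′ ⟨$⟩ʳ PC.transpose M₂.y M₂.x r         ≡⟨ ≈′ _ ⟩
    π₂′ ⟨$⟩ʳ PC.transpose M₂.y M₂.x r         ≡⟨ M₂.unswapped r ⟨
    π₂ ⟨$⟩ʳ r                                 ∎
    where
    open ≡-Reasoning
    module M₁ = Move M₁
    module M₂ = Move M₂
    f′≗ : M₁.f′ ≗ M₂.f′
    f′≗ r = cong (suc ∘ toℕ) (≈′ r)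
    same-x : M₁.x ≡ M₂.x
    same-x = toℕ-injective (trans (window M₁.embedding i) (sym (window M₂.embedding i)))
    x≺y₁ : M₂.f′ M₂.x ≺ M₂.f′ M₁.y
    x≺y₁ = subst₂ _≺_ (trans (f′≗ _) (cong M₂.f′ same-x)) (f′≗ _) (NextAfter.related M₁.y-next-after)
    x≺y₂ : M₁.f′ M₁.x ≺ M₁.f′ M₂.y
    x≺y₂ = subst₂ _≺_ (sym (trans (f′≗ _) (cong M₂.f′ same-x))) (sym (f′≗ _)) (NextAfter.related M₂.y-next-after)
    same-y : M₁.y ≡ M₂.y
    same-y with compare (M₁.f′ M₁.y) (M₁.f′ M₂.y)
    ... | tri< y₁≺y₂ _ _ = contradiction (subst₂ _≺_ (f′≗ _) (f′≗ _) y₁≺y₂)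
            (M₂.gap′ (start≤ M₁.embedding (fromℕ k)) x≺y₁)
    ... | tri≈ _ y₁≡y₂ _ = oneLine-injective π₁′ y₁≡y₂
    ... | tri> _ _ y₂≺y₁ = contradiction y₂≺y₁ (M₁.gap′ (start≤ M₂.embedding (fromℕ k)) x≺y₂)

  -- Last moves are removed in pairs. Both paths run out together: an exhausted path has reached a
  -- start without violation, whereas a remaining move would have left one.
  path-backwards-unique : ∀ {j π₁ π₂ π₁′ π₂′} → π₁′ ≈ₚ π₂′ → Path j π₁′ π₁ → Path j π₂′ π₂ →
    ¬ Violation _≺_ π₁ j → ¬ Violation _≺_ π₂ j → π₁ ≈ₚ π₂
  path-backwards-unique ≈′ ε        ε        _ _ = ≈′
  path-backwards-unique {π₁′ = π₁′} {π₂′} ≈′ ε (M ◅ _)  c _ =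
    contradiction (violation-resp-≈ π₂′ π₁′ (sym ∘ ≈′) (move-violates M)) c
  path-backwards-unique {π₁′ = π₁′} {π₂′} ≈′ (M ◅ _) ε    _ c =
    contradiction (violation-resp-≈ π₁′ π₂′ ≈′ (move-violates M)) c
  path-backwards-unique ≈′ (M₁ ◅ P₁) (M₂ ◅ P₂) =
    path-backwards-unique (move-backwards-unique ≈′ M₁ M₂) P₁ P₂

  -- Treating the windows from left to right

  ◁-wellFounded : ∀ {m} (f : Fin m → ℕ) → WellFounded (_≺_ on f)
  ◁-wellFounded f = spo-wellFounded (On.isStrictPartialOrder f (IsStrictTotalOrder.isStrictPartialOrder isSTO))

  ▷-wellFounded : ∀ {m} (f : Fin m → ℕ) → WellFounded (flip (_≺_ on f))
  ▷-wellFounded f = spo-noetherian (On.isStrictPartialOrder f (IsStrictTotalOrder.isStrictPartialOrder isSTO))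

  maximal : ∀ {P : Pred (Fin n) 0ℓ} → Decidable P → (f : Fin n → ℕ) →
    ∃[ r ] P r → ∃[ r ] (P r × (∀ r′ → P r′ → ¬ f r ≺ f r′))
  maximal {P} P? f (r , Pr) = climb r Pr (▷-wellFounded f r)
    where
    climb : ∀ r → P r → Acc (flip (_≺_ on f)) r → ∃[ r ] (P r × (∀ r′ → P r′ → ¬ f r ≺ f r′))
    climb r Pr (acc rec) with any? (λ r′ → P? r′ ×-dec (f r ≺? f r′))
    ... | yes (r′ , Pr′ , r≺r′) = climb r′ Pr′ (rec r≺r′)
    ... | no ¬higher            = r , Pr , λ r′ Pr′ r≺r′ → ¬higher (r′ , Pr′ , r≺r′)

  Match? : ∀ π w → Dec (Match π w)
  Match? π w = map′ orderIso compares (all? λ p → all? λ q →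
    (oneLine π (w p) ≺? oneLine π (w q)) ⇔-dec (s p ≺? s q))

  clean-suc : ∀ {j} π → OthersClean j π → ¬ Violation (flip _≺_) π j → Clean (suc j) π
  clean-suc {j} π others clean j′ = left , proj₂ (others j′)
    where
    left : j′ < suc j → ¬ Violation (flip _≺_) π j′
    left (s≤s j′≤j) with m≤n⇒m<n∨m≡n j′≤j
    ... | inj₁ j′<j = proj₁ (others j′) j′<j
    ... | inj₂ refl = clean

  -- Each swap lowers the i-th entry of the window, which is the measure of the recursion. It stops
  -- when the window does not match, when no entry from `j` on is below the i-th, or when the
  -- greatest such entry lies inside the window.
  descend : ∀ {j} (w : Fin k → Fin n) → (∀ p → toℕ (w p) ≡ j + toℕ p) →
    ∀ π π₀ → OthersClean j π → Path j π π₀ → Acc (_≺_ on suc ∘ toℕ {n}) (π ⟨$⟩ʳ w i) →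
    ∃[ π′ ] (Clean (suc j) π′ × Path j π′ π₀)
  descend {j} w win π π₀ others path (acc rec) with Match? π w
  ... | no ¬match = π , clean-suc π others no-violation , path
    where
    no-violation : ¬ Violation (flip _≺_) π j
    no-violation (e , emb , match , _) = ¬match
      (∼[]-trans (≗⇒∼[] λ p → cong (oneLine π) (toℕ-injective (trans (win p) (sym (window emb p))))) match)
  ... | yes match with any? (λ r → (j ≤? toℕ r) ×-dec (oneLine π r ≺? oneLine π (w i)))
  ...   | no none = π , clean-suc π others no-violation , path
    where
    no-violation : ¬ Violation (flip _≺_) π j
    no-violation (e , emb , _ , nextAfter next _) = none
      (e (fromℕ k) , start≤ emb _ , subst (λ x → _ ≺ oneLine π x) (toℕ-injective (trans (window emb i) (sym (win i)))) next)
  ...   | yes some with maximal (λ r → (j ≤? toℕ r) ×-dec (oneLine π r ≺? oneLine π (w i))) (oneLine π) some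
  ...     | y , (j≤y , y≺x) , max with j + k ≤? toℕ y
  ...       | no y-inside = π , clean-suc π others no-violation , path
    where
    no-violation : ¬ Violation (flip _≺_) π j
    -- The extra entry of a violation would lie strictly between `y`, which is in the window, and
    -- the i-th entry, against the maximality of `y`.
    no-violation (e , emb , _ , nextAfter next closest) = max (e (fromℕ k))
      (start≤ emb _ , subst (λ x → _ ≺ oneLine π x) x≡ next)
      (subst (λ z → f z ≺ _) (sym y≡) (closest p (subst₂ (λ u v → f u ≺ f v) y≡ (sym x≡) y≺x)))
      where
      f = oneLine π
      x≡ : e (inject₁ i) ≡ w i
      x≡ = toℕ-injective (trans (window emb i) (sym (win i)))
      offset< : toℕ y ∸ j < k
      offset< = +-cancelˡ-< j _ _ (subst (_< j + k) (sym (m+[n∸m]≡n j≤y)) (≰⇒> y-inside))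
      p : Fin k
      p = fromℕ< offset<
      y≡ : y ≡ e (inject₁ p)
      y≡ = toℕ-injective (sym (trans (window emb p)
             (trans (cong (j +_) (toℕ-fromℕ< offset<)) (m+[n∸m]≡n j≤y))))
  ...       | yes y-beyond = descend w win π′ π₀ (others-clean move others) (move ◅ path)
                (rec (subst (_≺ oneLine π (w i)) (sym at-wi) y≺x))
    where
    f = oneLine π
    e = snoc w y
    e-inject₁ : ∀ p → e (inject₁ p) ≡ w p
    e-inject₁ = snoc-inject₁ w y
    e-fromℕ : e (fromℕ k) ≡ y
    e-fromℕ = snoc-fromℕ w y
    π′ = transpose (e (inject₁ i)) (e (fromℕ k)) ∘ₚ π
    move : Move j π π′
    move = record
      { e         = e
      ; embedding = record
        { window = λ p → trans (cong toℕ (e-inject₁ p)) (win p)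
        ; beyond = subst (λ r → j + k ≤ toℕ r) (sym e-fromℕ) y-beyond
        }
      ; match     = ∼[]-trans (≗⇒∼[] (cong f ∘ e-inject₁)) match
      ; below     = subst₂ (λ u v → f u ≺ f v) (sym e-fromℕ) (sym (e-inject₁ i)) y≺x
      ; gap       = λ r j≤r y≺r r≺x → max r
          (j≤r , subst (λ x → f r ≺ f x) (e-inject₁ i) r≺x)
          (subst (λ y → f y ≺ f r) e-fromℕ y≺r)
      ; swapped   = λ _ → refl
      }
    at-wi : oneLine π′ (w i) ≡ f y
    at-wi = trans (cong (oneLine π′) (sym (e-inject₁ i))) (trans (Move.at-x move) (cong f e-fromℕ))

  step : ∀ {j} π → Clean j π → ∃[ π′ ] (Clean (suc j) π′ × Path j π′ π)
  -- If `j + k` is not a position, no entry is left to the right of the window, and there is nothing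
  -- to treat.
  step {j} π clean with j + k <? n
  ... | yes j+k<n = descend w (λ p → toℕ-fromℕ< (bound p)) π π others ε (◁-wellFounded (suc ∘ toℕ) _)
    where
    bound : ∀ p → j + toℕ p < n
    bound p = <-trans (+-monoʳ-< j (toℕ<n p)) j+k<n
    w : Fin k → Fin n
    w p = fromℕ< (bound p)
    others : OthersClean j π
    others j′ = proj₁ (clean j′) , proj₂ (clean j′) ∘ <⇒≤
  ... | no j+k≮n = π , clean-suc π others no-violation , ε
    where
    others : OthersClean j π
    others j′ = proj₁ (clean j′) , proj₂ (clean j′) ∘ <⇒≤
    no-violation : ¬ Violation (flip _≺_) π j
    no-violation (e , emb , _) = j+k≮n (≤-<-trans (beyond emb) (toℕ<n (e (fromℕ k))))

  transform : ∀ j π → Clean 0 π → ∃[ π′ ] Clean j π′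
  transform 0       π clean = π , clean
  transform (suc j) π clean =
    let (π′ , clean′)     = transform j π clean
        (π″ , clean″ , _) = step π′ clean′
    in π″ , clean″

  -- The windows are undone from right to left. Before window `j` is treated, `Clean j` excludes a
  -- violation for `_≺_` there, as backward uniqueness requires.
  transform-injective : ∀ j {π ρ} (c : Clean 0 π) (d : Clean 0 ρ) →
    proj₁ (transform j π c) ≈ₚ proj₁ (transform j ρ d) → π ≈ₚ ρ
  transform-injective 0       c d ≈′ = ≈′
  transform-injective (suc j) {π} {ρ} c d ≈′ =
    let (π′ , c′)   = transform j π c
        (ρ′ , d′)   = transform j ρ d
        (_ , _ , P) = step π′ c′
        (_ , _ , Q) = step ρ′ d′
    in transform-injective j c d
         (path-backwards-unique ≈′ P Q (proj₂ (c′ j) ≤-refl) (proj₂ (d′ j) ≤-refl))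

-- Overlaps of matching windows

-- Windows shifted by `k ∸ z` share `z` positions: a suffix of the first and a prefix of the second.
-- The entries there are isomorphic to both parts of `s`.
selfOverlap : ∀ {R} {s : Vector ℕ k} {z} (z≤k : z ≤ k) (f : Fin n → ℕ) {e e′} →
  Embedding j e → Embedding (j + (k ∸ z)) e′ →
  f ∘ e ∘ inject₁ ∼[ R ] s → f ∘ e′ ∘ inject₁ ∼[ R ] s →
  prefix z≤k s ∼[ R ] suffix z≤k s
selfOverlap {k} {j = j} {z = z} z≤k f {e} {e′} emb emb′ m m′ =
  ∼[]-trans (∼[]-sym (∼[]-∘ (λ p → inject≤ p z≤k) m′))
    (∼[]-trans (≗⇒∼[] (cong f ∘ common)) (∼[]-∘ shift m))
  where
  open ≡-Reasoning
  shift : Fin z → Fin k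
  shift p = cast (m∸n+n≡m z≤k) ((k ∸ z) ↑ʳ p)
  common : ∀ p → e′ (inject₁ (inject≤ p z≤k)) ≡ e (inject₁ (shift p))
  common p = toℕ-injective (begin
    toℕ (e′ (inject₁ (inject≤ p z≤k)))  ≡⟨ window emb′ _ ⟩
    j + (k ∸ z) + toℕ (inject≤ p z≤k)   ≡⟨ cong (j + (k ∸ z) +_) (toℕ-inject≤ p z≤k) ⟩
    j + (k ∸ z) + toℕ p                 ≡⟨ +-assoc j (k ∸ z) (toℕ p) ⟩
    j + (k ∸ z + toℕ p)                 ≡⟨ cong (j +_) (toℕ-↑ʳ (k ∸ z) p) ⟨
    j + toℕ ((k ∸ z) ↑ʳ p)              ≡⟨ cong (j +_) (toℕ-cast (m∸n+n≡m z≤k) ((k ∸ z) ↑ʳ p)) ⟨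
    j + toℕ (shift p)                   ≡⟨ window emb (shift p) ⟨
    toℕ (e (inject₁ (shift p)))         ∎)

-- With shift `d` the overlap has length `k ∸ d`, less than `k` since `d` is positive. If `left`
-- fails, then `d ≤ a` and the overlap is at least `k ∸ a`; if `right` fails, then `a + d < k` and
-- it is at least `suc a`. Either bound reaches the minimum in the hypothesis, where i is counted
-- from 1.
isolatedMatches : (s : Vector ℕ k) (i : Fin k) →
  (∀ z → suc (toℕ i) ⊓ (k ∸ suc (toℕ i) + 1) ≤ z → (z<k : z < k) →
    ¬ (prefix (<⇒≤ z<k) s ∼ suffix (<⇒≤ z<k) s)) →
  IsolatedMatches _<_ s i n
isolatedMatches {k} s i no-overlap f {j} {j′} {e} {e′} emb emb′ m m′ j<j′ = left , right
  where
  a = toℕ i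
  d = j′ ∸ j

  clash : d ≤ k → ¬ (suc a ⊓ (k ∸ suc a + 1) ≤ k ∸ d)
  clash d≤k min≤ = no-overlap (k ∸ d) min≤ z<k (compares
    (selfOverlap (<⇒≤ z<k) f emb (subst (λ h → Embedding h e′) j′≡ emb′) m m′))
    where
    z<k : k ∸ d < k
    z<k = ∸-monoʳ-< {k} (m<n⇒0<n∸m j<j′) d≤k
    j′≡ : j′ ≡ j + (k ∸ (k ∸ d))
    j′≡ = sym (trans (cong (j +_) (m∸[m∸n]≡n d≤k)) (m+[n∸m]≡n (<⇒≤ j<j′)))

  left : j + a < j′
  left with j + a <? j′
  ... | yes lt = lt
  ... | no ¬lt = contradiction
      (≤-trans (m⊓n≤n (suc a) _) (begin
        k ∸ suc a + 1   ≡⟨ +-comm _ 1 ⟩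
        1 + (k ∸ suc a) ≡⟨ +-∸-assoc 1 (toℕ<n i) ⟨
        k ∸ a           ≤⟨ ∸-monoʳ-≤ k d≤a ⟩
        k ∸ d           ∎))
      (clash (≤-trans d≤a (<⇒≤ (toℕ<n i))))
    where
    open ≤-Reasoning
    d≤a : d ≤ a
    d≤a = m≤n+o⇒m∸n≤o j′ j (≮⇒≥ ¬lt)

  right : j + k ≤ j′ + a
  right with j + k ≤? j′ + a
  ... | yes le = le
  ... | no ¬le = contradiction
      (≤-trans (m⊓n≤m (suc a) _) (m+n≤o⇒m≤o∸n (suc a) a+d<k))
      (clash (≤-trans (m≤n+m d (suc a)) a+d<k))
    where
    a+d<k : a + d < k
    a+d<k = +-cancelˡ-< j _ _ (begin-strict
      j + (a + d)   ≡⟨ cong (j +_) (+-comm a d) ⟩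
      j + (d + a)   ≡⟨ +-assoc j d a ⟨
      j + d + a     ≡⟨ cong (_+ a) (m+[n∸m]≡n (<⇒≤ j<j′)) ⟩
      j′ + a        <⟨ ≰⇒> ¬le ⟩
      j + k         ∎)
      where open ≤-Reasoning

-- Extending an isomorphism of windows to the last entry

module _ {R : Rel ℕ 0ℓ} (isSTO : IsStrictTotalOrder _≡_ R) {i : Fin k} where
  open IsStrictTotalOrder isSTO renaming (trans to R-trans)

  -- No window entry separates the i-th from the last. The right side is a negation because the i-th
  -- entry itself is included.
  below-last : ∀ {a} → NextAfter R i a → ∀ p → R (a (inject₁ p)) (a (fromℕ k)) ⇔ (¬ R (a (inject₁ i)) (a (inject₁ p)))
  below-last {a} (nextAfter r closest) p = mk⇔ (λ p<last i<p → asym p<last (closest p i<p)) ⇐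
    where
    ⇐ : ¬ R (a (inject₁ i)) (a (inject₁ p)) → R (a (inject₁ p)) (a (fromℕ k))
    ⇐ ¬i<p with compare (a (inject₁ p)) (a (inject₁ i))
    ... | tri< p<i _ _ = R-trans p<i r
    ... | tri≈ _ p≡i _ = subst (λ h → R h (a (fromℕ k))) (sym p≡i) r
    ... | tri> _ _ i<p = contradiction i<p ¬i<p

  above-last : ∀ {a} → NextAfter R i a → ∀ p → R (a (fromℕ k)) (a (inject₁ p)) ⇔ R (a (inject₁ i)) (a (inject₁ p))
  above-last (nextAfter r closest) p = mk⇔ (R-trans r) (closest p)

  -- Comparisons with the last entry reduce to comparisons with the i-th, which the windows share.
  extend-∼ : ∀ {a b} → NextAfter R i a → NextAfter R i b → a ∘ inject₁ ∼[ R ] b ∘ inject₁ → a ∼[ R ] b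
  extend-∼ {a} {b} na nb a∼b = orderIso go
    where
    go : ∀ p q → R (a p) (a q) ⇔ R (b p) (b q)
    go p q with view p | view q
    ... | ‵inject₁ p | ‵inject₁ q = compares a∼b p q
    ... | ‵inject₁ p | ‵fromℕ     = mk⇔
      (λ lt → from (below-last nb p) (to (below-last na p) lt ∘ from (compares a∼b i p)))
      (λ lt → from (below-last na p) (to (below-last nb p) lt ∘ to (compares a∼b i p)))
    ... | ‵fromℕ     | ‵inject₁ q = mk⇔
      (from (above-last nb q) ∘ to (compares a∼b i q) ∘ to (above-last na q))
      (from (above-last na q) ∘ from (compares a∼b i q) ∘ to (above-last nb q))
    ... | ‵fromℕ     | ‵fromℕ     = mk⇔ (λ lt → contradiction lt (irrefl refl)) (λ lt → contradiction lt (irrefl refl))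

-- Occurrences

consecutive⇒offset : (e : Fin (suc k) → Fin n) →
  (∀ p q → toℕ q ≡ suc (toℕ p) → toℕ (e q) ≡ suc (toℕ (e p))) →
  ∀ p → toℕ (e p) ≡ toℕ (e zero) + toℕ p
consecutive⇒offset e adjacent zero = sym (+-identityʳ _)
consecutive⇒offset {k = suc k} e adjacent (suc p) = begin
  toℕ (e (suc p))              ≡⟨ consecutive⇒offset (e ∘ suc) (λ p q eq → adjacent (suc p) (suc q) (cong suc eq)) p ⟩
  toℕ (e (suc zero)) + toℕ p   ≡⟨ cong (_+ toℕ p) (adjacent zero (suc zero) refl) ⟩
  suc (toℕ (e zero) + toℕ p)   ≡⟨ +-suc _ _ ⟨
  toℕ (e zero) + suc (toℕ p)   ∎
  where open ≡-Reasoning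

occurrence⇒embedding : ∀ {k n} {σ : QuasiConsecutive (suc k)} {π : Permutation′ n} (o : Occurrence σ π) →
  ∃[ j ] Embedding j (Occurrence.index o)
occurrence⇒embedding {k} o = start , record { window = win ; beyond = bey }
  where
  open Occurrence o
  start : ℕ
  start = toℕ (index zero)
  win : ∀ p → toℕ (index (inject₁ p)) ≡ start + toℕ p
  win = consecutive⇒offset (index ∘ inject₁) adjacent
  bey : start + suc k ≤ toℕ (index (fromℕ (suc k)))
  -- The last window position is `start + k`, and the entry after the dash is strictly further
  -- right.
  bey = ≤-trans (≤-reflexive (begin
      start + suc k                                   ≡⟨ +-suc start k ⟩
      suc (start + k)                                 ≡⟨ cong (λ h → suc (start + h)) (toℕ-fromℕ k) ⟨
      suc (start + toℕ (fromℕ k))                     ≡⟨ cong suc (win (fromℕ k)) ⟨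
      suc (toℕ (index (inject₁ (fromℕ k))))           ∎))
    (increasing (inject₁ (fromℕ k)) (fromℕ (suc k))
      (≤-reflexive (cong suc (toℕ-inject₁ (fromℕ k)))))
    where open ≡-Reasoning

embedding-increasing : ∀ {e : Fin (suc k) → Fin n} → Embedding j e → ∀ p q → p <ᶠ q → e p <ᶠ e q
embedding-increasing {j = j} emb p q p<q with view p | view q
... | ‵inject₁ p | ‵inject₁ q = subst₂ _<_ (sym (window emb p)) (sym (window emb q))
        (+-monoʳ-< j (subst₂ _<_ (toℕ-inject₁ p) (toℕ-inject₁ q) p<q))
... | ‵inject₁ p | ‵fromℕ     = window<beyond emb p
... | ‵fromℕ {k} | ‵inject₁ q = contradiction p<q
        (<-asym (subst₂ _<_ (sym (toℕ-inject₁ q)) (sym (toℕ-fromℕ k)) (toℕ<n q)))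
... | ‵fromℕ     | ‵fromℕ     = contradiction p<q (<-irrefl refl)

embedding⇒occurrence : ∀ {σ : QuasiConsecutive k} {π : Permutation′ n} {e} → Embedding j e →
  oneLine π ∘ e ∼[ _<_ ] oneLine σ → Occurrence σ π
embedding⇒occurrence {j = j} {e = e} emb similar = record
  { index      = e
  ; increasing = embedding-increasing emb
  ; adjacent   = λ p q q≡1+p → trans (window emb q) (trans (cong (j +_) q≡1+p)
                   (trans (+-suc j (toℕ p)) (cong suc (sym (window emb p)))))
  ; similar    = compares similar
  }

module _
  {R : Rel ℕ 0ℓ} (isSTO : IsStrictTotalOrder _≡_ R)
  (<⇒R : ∀ {m} {a b : Vector ℕ m} → a ∼[ _<_ ] b → a ∼[ R ] b)
  (R⇒< : ∀ {m} {a b : Vector ℕ m} → a ∼[ R ] b → a ∼[ _<_ ] b)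
  {k n : ℕ} {i : Fin (suc k)} {s : Vector ℕ (suc k)} {σ τ : QuasiConsecutive (suc k)}
  (isolated : IsolatedMatches R s i n)
  (σ-match : consecutivePart σ ∼[ R ] s) (σ-next : NextAfter R i (oneLine σ))
  (τ-match : consecutivePart τ ∼[ R ] s) (τ-next : NextAfter (flip R) i (oneLine τ))
  where

  open Descent R isSTO {n = n} s i isolated

  -- At stage 0 only violations for `_≺_` are excluded, and by `extend-∼` each of them is an
  -- occurrence of `σ`.
  avoids⇒clean : ∀ {π : Permutation′ n} → Avoids σ π → Clean 0 π
  avoids⇒clean avoids j = (λ ()) , λ _ (e , emb , m , next) → avoids
    (embedding⇒occurrence emb (R⇒< (extend-∼ isSTO next σ-next (∼[]-trans m (∼[]-sym σ-match)))))

  -- Every window starts before `n`, so at stage `n` all have been treated.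
  clean⇒avoids : ∀ {π : Permutation′ n} → Clean n π → Avoids τ π
  clean⇒avoids {π} clean o with occurrence⇒embedding o
  ... | j , emb = proj₁ (clean j) (≤-<-trans (start≤ emb zero) (toℕ<n (Occurrence.index o zero)))
    (_ , emb , ∼[]-trans (∼[]-∘ inject₁ similar) τ-match , NextAfter-resp-∼ (∼[]-sym (∼[]-flip similar)) τ-next)
    where
    similar : oneLine π ∘ Occurrence.index o ∼[ R ] oneLine τ
    similar = <⇒R (orderIso (Occurrence.similar o))

  avoiders↣ : Σ[ g ∈ (Setoid.Carrier (S n σ) → Setoid.Carrier (S n τ)) ]
    (∀ {x y} → Setoid._≈_ (S n τ) (g x) (g y) → Setoid._≈_ (S n σ) x y)
  avoiders↣ =
    (λ (π , av) → let (π′ , clean) = transform n π (avoids⇒clean av) in π′ , clean⇒avoids clean) ,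
    λ {x} {y} → transform-injective n {proj₁ x} {proj₁ y} (avoids⇒clean (proj₂ x)) (avoids⇒clean (proj₂ y))

-- The pattern with two consecutive values interchanged

module _ {k : ℕ} (σ : QuasiConsecutive k) (i : Fin k)
  (adjacent-values : oneLine σ (fromℕ k) ≡ suc (oneLine σ (inject₁ i))) where

  private
    τ : QuasiConsecutive k
    τ = swapWithLast i σ
    c c′ : Fin (suc k) → ℕ
    c  = oneLine σ
    c′ = oneLine τ
    x y : Fin (suc k)
    x = inject₁ i
    y = fromℕ k
    x<y : c x < c y
    x<y = ≤-reflexive (sym adjacent-values)
    c′-x : c′ x ≡ c y
    c′-x = cong c (transpose-at-left x y)
    c′-y : c′ y ≡ c x
    c′-y = cong c (transpose-at-right x y)
    c′-else : ∀ {p} → p ≢ i → c′ (inject₁ p) ≡ c (inject₁ p)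
    c′-else p≢i = cong c (transpose-elsewhere (p≢i ∘ inject₁-injective) (fromℕ≢inject₁ ∘ sym))
    above : ∀ {p} → c x < c (inject₁ p) → c y < c (inject₁ p)
    above {p} lt = ≤∧≢⇒< (subst (_≤ c (inject₁ p)) (sym adjacent-values) lt)
      (fromℕ≢inject₁ ∘ oneLine-injective σ)
    below : ∀ {p} → p ≢ i → c (inject₁ p) < c y → c (inject₁ p) < c x
    below {p} p≢i lt = ≤∧≢⇒< (≤-pred (subst (c (inject₁ p) <_) adjacent-values lt))
      (p≢i ∘ inject₁-injective ∘ oneLine-injective σ)

  next-larger : NextAfter _<_ i (oneLine σ)
  next-larger = nextAfter x<y (λ _ → above)

  next-smaller-swapped : NextAfter _>_ i (oneLine (swapWithLast i σ))
  next-smaller-swapped = nextAfter (subst₂ _<_ (sym c′-y) (sym c′-x) x<y) closest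
    where
    closest : ∀ p → c′ (inject₁ p) < c′ x → c′ (inject₁ p) < c′ y
    closest p lt with p ≟ i
    ... | yes refl = contradiction lt (<-irrefl refl)
    ... | no p≢i   = subst₂ _<_ (sym (c′-else p≢i)) (sym c′-y) (below p≢i (subst₂ _<_ (c′-else p≢i) c′-x lt))

  -- The i-th entry only moves to the next value, so it passes no other entry of the consecutive
  -- part.
  consecutivePart-swapped : consecutivePart (swapWithLast i σ) ∼[ _<_ ] consecutivePart σ
  consecutivePart-swapped = orderIso go
    where
    go : ∀ p q → c′ (inject₁ p) < c′ (inject₁ q) ⇔ c (inject₁ p) < c (inject₁ q)
    go p q with p ≟ i | q ≟ i
    ... | yes refl | yes refl = mk⇔ (λ lt → contradiction lt (<-irrefl refl)) (λ lt → contradiction lt (<-irrefl refl))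
    ... | yes refl | no q≢i   = mk⇔
      (λ lt → <-trans x<y (subst₂ _<_ c′-x (c′-else q≢i) lt))
      (λ lt → subst₂ _<_ (sym c′-x) (sym (c′-else q≢i)) (above lt))
    ... | no p≢i   | yes refl = mk⇔
      (λ lt → below p≢i (subst₂ _<_ (c′-else p≢i) c′-x lt))
      (λ lt → subst₂ _<_ (sym (c′-else p≢i)) (sym c′-x) (<-trans lt x<y))
    ... | no p≢i   | no q≢i   = mk⇔
      (subst₂ _<_ (c′-else p≢i) (c′-else q≢i))
      (subst₂ _<_ (sym (c′-else p≢i)) (sym (c′-else q≢i)))

-- Cardinalities

lookup-injective : ∀ {A : Set} {xs : List A} → Unique xs → ∀ p q → lookup xs p ≡ lookup xs q → p ≡ q
lookup-injective (_ ∷ _)   zero    zero    _  = refl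
lookup-injective (x∉ ∷ _)  zero    (suc q) eq = contradiction eq (All.lookup x∉ (∈-lookup q))
lookup-injective (x∉ ∷ _)  (suc p) zero    eq = contradiction (sym eq) (All.lookup x∉ (∈-lookup p))
lookup-injective (_ ∷ xs!) (suc p) (suc q) eq = cong suc (lookup-injective xs! p q eq)

module _ {A : Setoid 0ℓ 0ℓ} {N : ℕ}
  (code : Setoid.Carrier A → Fin N) (code-cong : ∀ {x y} → Setoid._≈_ A x y → code x ≡ code y)
  (code-injective : ∀ {x y} → code x ≡ code y → Setoid._≈_ A x y)
  (image? : ∀ c → Dec (∃[ x ] code x ≡ c)) where

  private
    codes : List (Fin N)
    codes = filter image? (allFin N)

    position : Setoid.Carrier A → Fin (length codes)
    position x = Any.index (∈-filter⁺ image? (∈-allFin (code x)) (x , refl))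

    lookup-position : ∀ x → lookup codes (position x) ≡ code x
    lookup-position x = sym (lookup-index (∈-filter⁺ image? (∈-allFin (code x)) (x , refl)))

    decode : ∀ p → ∃[ x ] code x ≡ lookup codes p
    decode p = proj₂ (∈-filter⁻ image? {xs = allFin N} (∈-lookup p))

    same-position : ∀ {p q} → lookup codes p ≡ lookup codes q → p ≡ q
    same-position = lookup-injective (filter⁺ image? (allFin⁺ N)) _ _

  -- The codes in the image form a list without repetition, and an element is numbered by the place
  -- of its code in that list.
  encodable⇒finite : ∃[ c ] HasCardinality A c
  encodable⇒finite = length codes , record
    { to        = position
    ; from      = proj₁ ∘ decode
    ; to-cong   = λ {x} {y} x≈y → same-position
        (trans (lookup-position x) (trans (code-cong x≈y) (sym (lookup-position y))))
    ; from-cong = λ { refl → Setoid.refl A }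
    ; inverse   =
        (λ {p} {x} x≈ → same-position (trans (lookup-position x) (trans (code-cong x≈) (proj₂ (decode p))))) ,
        (λ {x} {p} p≡ → code-injective
          (trans (proj₂ (decode p)) (trans (cong (lookup codes) p≡) (lookup-position x))))
    }

cardinality-≤ : ∀ {A B : Setoid 0ℓ 0ℓ} {c d} → HasCardinality A c → HasCardinality B d →
  (g : Setoid.Carrier A → Setoid.Carrier B) →
  (∀ {x y} → Setoid._≈_ B (g x) (g y) → Setoid._≈_ A x y) → c ≤ d
cardinality-≤ A↔c B↔d g g-injective = injective⇒≤ {f = Inverse.to B↔d ∘ g ∘ Inverse.from A↔c}
  (Injection.injective (Inverse⇒Injection (inverse-sym A↔c)) ∘ g-injective ∘
   Injection.injective (Inverse⇒Injection B↔d))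

-- Index functions are searched through their codes in a finite set; decoding returns a function
-- only up to pointwise equality, whence the transport along `same`.
occurrence? : (σ : QuasiConsecutive k) (π : Permutation′ n) → Dec (Occurrence σ π)
occurrence? {k} {n} σ π = map′ ⇒ ⇐ (any? λ c → isOccurrence? (finToFun c))
  where
  IsOccurrence : (Fin (suc k) → Fin n) → Set
  IsOccurrence e =
    (∀ p q → p <ᶠ q → e p <ᶠ e q) ×
    (∀ (p q : Fin k) → toℕ q ≡ suc (toℕ p) → toℕ (e (inject₁ q)) ≡ suc (toℕ (e (inject₁ p)))) ×
    oneLine π ∘ e ∼ oneLine σ

  isOccurrence? : ∀ e → Dec (IsOccurrence e)
  isOccurrence? e =
    (all? λ p → all? λ q → (p Fin.<? q) →-dec (e p Fin.<? e q)) ×-dec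
    (all? λ p → all? λ q → (toℕ q ℕ.≟ suc (toℕ p)) →-dec (toℕ (e (inject₁ q)) ℕ.≟ suc (toℕ (e (inject₁ p))))) ×-dec
    (all? λ p → all? λ q → (oneLine π (e p) <? oneLine π (e q)) ⇔-dec (oneLine σ p <? oneLine σ q))

  ⇒ : ∃[ c ] IsOccurrence (finToFun c) → Occurrence σ π
  ⇒ (c , inc , adj , sim) = record { index = finToFun c ; increasing = inc ; adjacent = adj ; similar = sim }

  ⇐ : Occurrence σ π → ∃[ c ] IsOccurrence (finToFun c)
  ⇐ o = funToFin index ,
    (λ p q p<q → subst₂ _<ᶠ_ (same p) (same q) (increasing p q p<q)) ,
    (λ p q eq → subst₂ (λ u v → toℕ u ≡ suc (toℕ v)) (same _) (same _) (adjacent p q eq)) ,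
    compares (∼[]-trans (≗⇒∼[] (cong (oneLine π) ∘ sym ∘ same)) (orderIso {R = _<_} {b = oneLine σ} similar))
    where
    open Occurrence o
    same : index ≗ finToFun (funToFin index)
    same = sym ∘ finToFun-funToFin index

occurrence-resp-≈ : ∀ {σ : QuasiConsecutive k} (π ρ : Permutation′ n) → π ≈ₚ ρ → Occurrence σ π → Occurrence σ ρ
occurrence-resp-≈ {σ = σ} π ρ π≈ρ o = record
  { index      = index
  ; increasing = increasing
  ; adjacent   = adjacent
  ; similar    = compares (∼[]-trans (≗⇒∼[] (λ p → cong (suc ∘ toℕ) (sym (π≈ρ (index p)))))
                   (orderIso {R = _<_} {b = oneLine σ} similar))
  }
  where open Occurrence o

funToFin-cong : ∀ {f g : Fin m → Fin n} → f ≗ g → funToFin f ≡ funToFin g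
funToFin-cong {zero}  f≗g = refl
funToFin-cong {suc m} f≗g = cong₂ combine (f≗g zero) (funToFin-cong (f≗g ∘ suc))

S-finite : ∀ n (σ : QuasiConsecutive k) → ∃[ c ] HasCardinality (S n σ) c
S-finite n σ = encodable⇒finite {A = S n σ} code funToFin-cong
  (λ {x} {y} eq p → trans (sym (finToFun-funToFin (proj₁ x ⟨$⟩ʳ_) p))
    (trans (cong (λ c → finToFun c p) eq) (finToFun-funToFin (proj₁ y ⟨$⟩ʳ_) p)))
  image?
  where
  code : Setoid.Carrier (S n σ) → Fin (n ^ n)
  code (π , _) = funToFin (π ⟨$⟩ʳ_)

  decoded : ∀ {c} ((π , _) : Setoid.Carrier (S n σ)) → funToFin (π ⟨$⟩ʳ_) ≡ c → finToFun c ≗ (π ⟨$⟩ʳ_)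
  decoded (π , _) refl = finToFun-funToFin (π ⟨$⟩ʳ_)

  image? : ∀ c → Dec (∃[ x ] code x ≡ c)
  image? c with any? (λ d → all? (λ p → finToFun c (finToFun d p) ≟ p) ×-dec
                            all? (λ p → finToFun {n} {n} d (finToFun c p) ≟ p))
  -- A code belongs to a permutation exactly when some code `d` decodes to a two-sided inverse;
  -- avoidance is then decided for that permutation.
  ... | no ¬invertible = no λ (x@(π , _) , eq) → ¬invertible
    ( funToFin (π ⟨$⟩ˡ_)
    , (λ p → trans (decoded x eq _) (trans (cong (π ⟨$⟩ʳ_) (finToFun-funToFin (π ⟨$⟩ˡ_) p)) (inverseʳ π)))
    , (λ p → trans (finToFun-funToFin (π ⟨$⟩ˡ_) _) (trans (cong (π ⟨$⟩ˡ_) (decoded x eq p)) (inverseˡ π)))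
    )
  ... | yes (d , fg , gf) = decide (permutation (finToFun c) (finToFun d) fg gf) (λ _ → refl)
    where
    decide : (ρ : Permutation′ n) → finToFun c ≗ (ρ ⟨$⟩ʳ_) → Dec (∃[ x ] code x ≡ c)
    decide ρ c≗ρ with occurrence? σ ρ
    ... | yes o = no λ (x@(π , avoids) , eq) → avoids
            (occurrence-resp-≈ ρ π (λ p → trans (sym (c≗ρ p)) (decoded x eq p)) o)
    ... | no ¬o = yes ((ρ , ¬o) , trans (funToFin-cong (sym ∘ c≗ρ)) (funToFin-finToFin {n} {n} c))

theorem4p7 : ∀ (k : ℕ) → 3 ≤ k → (σ : QuasiConsecutive k) (i : Fin k) →
    2 ≤ suc (toℕ i) → suc (toℕ i) ≤ k ∸ 1 →
    lastEntry σ ≡ consecutivePart σ i + 1 →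
    (∀ z → suc (toℕ i) ⊓ (k ∸ suc (toℕ i) + 1) ≤ z → (z<k : z < k) →
    ¬ (prefix (<⇒≤ z<k) (consecutivePart σ) ∼ suffix (<⇒≤ z<k) (consecutivePart σ))) →
    WilfEquivalent σ (swapWithLast i σ)
theorem4p7 (suc k) _ σ i _ _ last≡ no-overlap n _
  with S-finite n σ | S-finite n (swapWithLast i σ)
... | c , Sσ↔c | d , Sτ↔d = c , Sσ↔c , subst (HasCardinality (S n τ)) (sym c≡d) Sτ↔d
  where
  τ : QuasiConsecutive (suc k)
  τ = swapWithLast i σ
  last≡suc : lastEntry σ ≡ suc (consecutivePart σ i)
  last≡suc = trans last≡ (+-comm _ 1)
  isolated : IsolatedMatches _<_ (consecutivePart σ) i n
  isolated = isolatedMatches (consecutivePart σ) i no-overlap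
  σ↣τ = avoiders↣ {R = _<_} <-isStrictTotalOrder id id {σ = σ} {τ = τ} isolated
    (≗⇒∼[] λ _ → refl) (next-larger σ i last≡suc)
    (consecutivePart-swapped σ i last≡suc) (next-smaller-swapped σ i last≡suc)
  -- In the reversed order the roles are exchanged: the last entry of `τ` comes next after its i-th,
  -- and that of `σ` next before. The matched sequence remains that of `σ`.
  τ↣σ = avoiders↣ {R = _>_} (Flip.isStrictTotalOrder <-isStrictTotalOrder) ∼[]-flip ∼[]-flip {σ = τ} {τ = σ}
    (λ f emb emb′ m m′ → isolated f emb emb′ (∼[]-flip m) (∼[]-flip m′))
    (∼[]-flip (consecutivePart-swapped σ i last≡suc)) (next-smaller-swapped σ i last≡suc)
    (≗⇒∼[] λ _ → refl) (next-larger σ i last≡suc)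
  c≡d : c ≡ d
  c≡d = ≤-antisym
    (cardinality-≤ Sσ↔c Sτ↔d (proj₁ σ↣τ) (λ {x} {y} → proj₂ σ↣τ {x} {y}))
    (cardinality-≤ Sτ↔d Sσ↔c (proj₁ τ↣σ) (λ {x} {y} → proj₂ τ↣σ {x} {y}))
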